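{- Let $B=F(b_1,\ldots,b_n)$ be a Ferrers board with $0\le b_1\le\cdots\le b_n$. Then, as polynomials in $x$, $$x^n=\sum_{k=0}^n \mathbf{rT}_{n-k}(B,p,q)\,(x-F_{b_1}(p,q))(x-F_{b_2}(p,q))\cdots(x-F_{b_k}(p,q)),$$ where the empty product ($k=0$) equals 1.
   Context: For $m\ge 1$, a Fibonacci tiling of height $m$ is a tiling of a column of height $m$ by tiles of height 1 and height 2 whose bottom-most tile has height 1. For such a tiling $T$, $\mathrm{one}(T)$ and $\mathrm{two}(T)$ denote the numbers of tiles of height 1 and 2, and $F_m(p,q)=\sum_T q^{\mathrm{one}(T)}p^{\mathrm{two}(T)}$ over all Fibonacci tilings of height $m$ (so $F_1=q$, $F_2=q^2$, $F_m=qF_{m-1}+pF_{m-2}$ for $m\ge 3$). There are no Fibonacci tilings of height $0$, and $F_0(p,q)=0$. A Ferrers board $F(b_1,\ldots,b_n)$ is the board whose columns, from left to right, have heights $b_1,\ldots,b_n$. A Fibonacci rook placement of $k$ tilings in $B=F(b_1,\ldots,b_n)$ consists of a choice of columns $1\le i_1<\cdots<i_k\le n$ together with, for each $s=1,\ldots,k$, a Fibonacci tiling of height $b_{i_s-(s-1)}$ placed in column $i_s$ (the number of cells of column $i_s$ not canceled by earlier tilings, each tiling canceling top cells of columns to its right so that after $s$ tilings the untiled columns have $b_1,\ldots,b_{n-s}$ uncanceled cells). Its weight is $q^{a}p^{b}$ where $a$ (resp. $b$) is the total number of tiles of height 1 (resp. 2) used. $\mathbf{rT}_k(B,p,q)$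 is the sum of the weights of all Fibonacci rook placements of $k$ tilings in $B$ (the empty placement has weight 1). -}

module Defs where

open import Algebra.Bundles using (CommutativeRing)
open import Algebra.Structures using (IsCommutativeRing)
open import Data.Empty using (⊥)
open import Data.Fin.Base as Fin using (Fin; zero; suc; toℕ; pred)
import Data.Fin.Properties as Fin
open import Data.Integer.Properties using () renaming (+-*-commutativeRing to ℤ-ring)
open import Data.List.Base as List
  using (List; []; _∷_; _++_; concatMap; cartesianProductWith)
open import Data.List.Membership.Propositional using (_∈_)
open import Data.List.Membership.Propositional.Properties
  using (∈-map⁺; ∈-map⁻; ∈-++⁺ˡ; ∈-++⁺ʳ; ∈-concatMap⁺; ∈-cartesianProductWith⁺)
open import Data.List.Relation.Unary.Any as Any using (here)
import Data.List.Relation.Unary.All as ListAll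
import Data.List.Relation.Unary.All.Properties as ListAllₚ
import Data.List.Relation.Unary.AllPairs as ListAllPairs
import Data.List.Relation.Unary.AllPairs.Properties as ListAllPairsₚ
open import Data.List.Relation.Unary.Unique.Propositional using (Unique)
import Data.List.Relation.Unary.Unique.Propositional.Properties as Unique
open import Data.Nat.Base as ℕ using (ℕ; zero; suc; z≤n; s≤s)
import Data.Nat.Properties as ℕ
open import Data.Product.Base using (∃; _×_; _,_)
open import Data.Vec.Base as Vec using (Vec; []; _∷_)
open import Data.Vec.Properties using (∷-injectiveʳ)
open import Data.Vec.Relation.Unary.All as All using (All; []; _∷_)
import Data.Vec.Relation.Unary.All.Properties as All
open import Data.Vec.Relation.Unary.AllPairs as AllPairs using (AllPairs; []; _∷_)
import Data.Vec.Relation.Unary.AllPairs.Properties as AllPairs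
open import Function.Base using (_∘_)
open import Level using (0ℓ)
open import Relation.Binary.PropositionalEquality as ≡ using (_≡_; _≢_; refl)

module Polynomials {c ℓ} (R : CommutativeRing c ℓ) where

  open CommutativeRing R hiding (zero) renaming (Carrier to A; refl to ≈-refl)
  open import Algebra.Properties.Ring ring using (-0#≈0#)
  open import Algebra.Properties.CommutativeSemigroup +-commutativeSemigroup
    using (interchange)

  -- Coefficients in order of increasing degree; trailing zeros are allowed,
  -- hence equality is coefficientwise.
  Poly : Set c
  Poly = List A

  coeff : Poly → ℕ → A
  coeff []      _       = 0#
  coeff (a ∷ f) zero    = a
  coeff (a ∷ f) (suc i) = coeff f i

  infix 4 _≈ₚ_
  record _≈ₚ_ (f g : Poly) : Set ℓ where
    constructor coeffwise
    field at : ∀ i → coeff f i ≈ coeff g i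
  open _≈ₚ_ public

  infixl 6 _+ₚ_
  infixl 7 _*ₚ_ _·ₚ_

  _+ₚ_ : Poly → Poly → Poly
  []      +ₚ g       = g
  (a ∷ f) +ₚ []      = a ∷ f
  (a ∷ f) +ₚ (b ∷ g) = a + b ∷ f +ₚ g

  -ₚ_ : Poly → Poly
  -ₚ_ = List.map (-_)

  _·ₚ_ : A → Poly → Poly
  a ·ₚ f = List.map (a *_) f

  _*ₚ_ : Poly → Poly → Poly
  []      *ₚ g = []
  (a ∷ f) *ₚ g = a ·ₚ g +ₚ (0# ∷ f *ₚ g)

  C : A → Poly
  C a = a ∷ []

  X : Poly
  X = 0# ∷ 1# ∷ []

  0ₚ 1ₚ : Poly
  0ₚ = []
  1ₚ = C 1#

  reflₚ : ∀ {f} → f ≈ₚ f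
  reflₚ = coeffwise λ _ → ≈-refl

  symₚ : ∀ {f g} → f ≈ₚ g → g ≈ₚ f
  symₚ e = coeffwise λ i → sym (at e i)

  transₚ : ∀ {f g h} → f ≈ₚ g → g ≈ₚ h → f ≈ₚ h
  transₚ d e = coeffwise λ i → trans (at d i) (at e i)

  coeff-+ : ∀ f g i → coeff (f +ₚ g) i ≈ coeff f i + coeff g i
  coeff-+ []      g       i       = sym (+-identityˡ _)
  coeff-+ (a ∷ f) []      i       = sym (+-identityʳ _)
  coeff-+ (a ∷ f) (b ∷ g) zero    = ≈-refl
  coeff-+ (a ∷ f) (b ∷ g) (suc i) = coeff-+ f g i

  coeff-neg : ∀ f i → coeff (-ₚ f) i ≈ - coeff f i
  coeff-neg []      i       = sym -0#≈0#
  coeff-neg (a ∷ f) zero    = ≈-refl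
  coeff-neg (a ∷ f) (suc i) = coeff-neg f i

  coeff-· : ∀ a f i → coeff (a ·ₚ f) i ≈ a * coeff f i
  coeff-· a []      i       = sym (zeroʳ a)
  coeff-· a (b ∷ f) zero    = ≈-refl
  coeff-· a (b ∷ f) (suc i) = coeff-· a f i

  ∷-cong : ∀ {a b f g} → a ≈ b → f ≈ₚ g → a ∷ f ≈ₚ b ∷ g
  ∷-cong a≈b f≈g = coeffwise λ where
    zero    → a≈b
    (suc i) → at f≈g i

  tail-cong : ∀ {a b f g} → a ∷ f ≈ₚ b ∷ g → f ≈ₚ g
  tail-cong e = coeffwise (at e ∘ suc)

  0∷0 : 0# ∷ [] ≈ₚ []
  0∷0 = coeffwise λ where
    zero    → ≈-refl
    (suc i) → ≈-refl

  +ₚ-cong : ∀ {f g h k} → f ≈ₚ g → h ≈ₚ k → f +ₚ h ≈ₚ g +ₚ k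
  +ₚ-cong {f} {g} {h} {k} d e = coeffwise λ i →
    trans (coeff-+ f h i) (trans (+-cong (at d i) (at e i)) (sym (coeff-+ g k i)))

  +ₚ-assoc : ∀ f g h → (f +ₚ g) +ₚ h ≈ₚ f +ₚ (g +ₚ h)
  +ₚ-assoc f g h = coeffwise λ i →
    trans (coeff-+ (f +ₚ g) h i) (trans (+-congʳ (coeff-+ f g i))
      (trans (+-assoc _ _ _) (sym (trans (coeff-+ f (g +ₚ h) i) (+-congˡ (coeff-+ g h i))))))

  +ₚ-comm : ∀ f g → f +ₚ g ≈ₚ g +ₚ f
  +ₚ-comm f g = coeffwise λ i →
    trans (coeff-+ f g i) (trans (+-comm _ _) (sym (coeff-+ g f i)))

  +ₚ-identityʳ : ∀ f → f +ₚ [] ≈ₚ f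
  +ₚ-identityʳ f = coeffwise λ i → trans (coeff-+ f [] i) (+-identityʳ _)

  -ₚ-cong : ∀ {f g} → f ≈ₚ g → -ₚ f ≈ₚ -ₚ g
  -ₚ-cong {f} {g} e = coeffwise λ i →
    trans (coeff-neg f i) (trans (-‿cong (at e i)) (sym (coeff-neg g i)))

  -ₚ-inverseʳ : ∀ f → f +ₚ (-ₚ f) ≈ₚ []
  -ₚ-inverseʳ f = coeffwise λ i →
    trans (coeff-+ f (-ₚ f) i) (trans (+-congˡ (coeff-neg f i)) (-‿inverseʳ _))

  -ₚ-inverseˡ : ∀ f → (-ₚ f) +ₚ f ≈ₚ []
  -ₚ-inverseˡ f = transₚ (+ₚ-comm (-ₚ f) f) (-ₚ-inverseʳ f)

  +ₚ-interchange : ∀ f g h k → (f +ₚ g) +ₚ (h +ₚ k) ≈ₚ (f +ₚ h) +ₚ (g +ₚ k)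
  +ₚ-interchange f g h k = coeffwise λ i →
    trans (coeff-+ (f +ₚ g) (h +ₚ k) i)
      (trans (+-cong (coeff-+ f g i) (coeff-+ h k i))
        (trans (interchange _ _ _ _)
          (sym (trans (coeff-+ (f +ₚ h) (g +ₚ k) i)
            (+-cong (coeff-+ f h i) (coeff-+ g k i))))))

  +ₚ-swap : ∀ f g h → f +ₚ (g +ₚ h) ≈ₚ g +ₚ (f +ₚ h)
  +ₚ-swap f g h = transₚ (symₚ (+ₚ-assoc f g h))
    (transₚ (+ₚ-cong (+ₚ-comm f g) reflₚ) (+ₚ-assoc g f h))

  ·-cong : ∀ {a b f g} → a ≈ b → f ≈ₚ g → a ·ₚ f ≈ₚ b ·ₚ g
  ·-cong {a} {b} {f} {g} d e = coeffwise λ i →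
    trans (coeff-· a f i) (trans (*-cong d (at e i)) (sym (coeff-· b g i)))

  ·-zeroˡ : ∀ f → 0# ·ₚ f ≈ₚ []
  ·-zeroˡ f = coeffwise λ i → trans (coeff-· 0# f i) (zeroˡ _)

  ·-identityˡ : ∀ f → 1# ·ₚ f ≈ₚ f
  ·-identityˡ f = coeffwise λ i → trans (coeff-· 1# f i) (*-identityˡ _)

  ·-distribʳ : ∀ a b f → (a + b) ·ₚ f ≈ₚ a ·ₚ f +ₚ b ·ₚ f
  ·-distribʳ a b f = coeffwise λ i →
    trans (coeff-· (a + b) f i) (trans (distribʳ _ a b)
      (sym (trans (coeff-+ (a ·ₚ f) (b ·ₚ f) i) (+-cong (coeff-· a f i) (coeff-· b f i)))))

  ·-distribˡ : ∀ a f g → a ·ₚ (f +ₚ g) ≈ₚ a ·ₚ f +ₚ a ·ₚ g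
  ·-distribˡ a f g = coeffwise λ i →
    trans (coeff-· a (f +ₚ g) i) (trans (*-congˡ (coeff-+ f g i)) (trans (distribˡ a _ _)
      (sym (trans (coeff-+ (a ·ₚ f) (a ·ₚ g) i) (+-cong (coeff-· a f i) (coeff-· a g i))))))

  ·-assoc : ∀ a b f → (a * b) ·ₚ f ≈ₚ a ·ₚ (b ·ₚ f)
  ·-assoc a b f = coeffwise λ i →
    trans (coeff-· (a * b) f i) (trans (*-assoc _ _ _)
      (sym (trans (coeff-· a (b ·ₚ f) i) (*-congˡ (coeff-· b f i)))))

  *ₚ-congˡ : ∀ f {g h} → g ≈ₚ h → f *ₚ g ≈ₚ f *ₚ h
  *ₚ-congˡ []      e = reflₚ
  *ₚ-congˡ (a ∷ f) e =
    +ₚ-cong (·-cong ≈-refl e)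
            (∷-cong ≈-refl (*ₚ-congˡ f e))

  *ₚ-zeroˡ : ∀ f g → f ≈ₚ [] → f *ₚ g ≈ₚ []
  *ₚ-zeroˡ []      g e = reflₚ
  *ₚ-zeroˡ (a ∷ f) g e = +ₚ-cong
    (transₚ (·-cong (at e zero) reflₚ) (·-zeroˡ g))
    (transₚ (∷-cong ≈-refl (*ₚ-zeroˡ f g (coeffwise (at e ∘ suc)))) 0∷0)

  *ₚ-congʳ : ∀ {f g} h → f ≈ₚ g → f *ₚ h ≈ₚ g *ₚ h
  *ₚ-congʳ {[]}    {g}     h e = symₚ (*ₚ-zeroˡ g h (symₚ e))
  *ₚ-congʳ {a ∷ f} {[]}    h e = *ₚ-zeroˡ (a ∷ f) h e
  *ₚ-congʳ {a ∷ f} {b ∷ g} h e = +ₚ-cong (·-cong (at e zero) reflₚ)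
    (∷-cong ≈-refl (*ₚ-congʳ h (tail-cong e)))

  *ₚ-cong : ∀ {f g h k} → f ≈ₚ g → h ≈ₚ k → f *ₚ h ≈ₚ g *ₚ k
  *ₚ-cong {g = g} {h} d e = transₚ (*ₚ-congʳ h d) (*ₚ-congˡ g e)

  *ₚ-distribʳ : ∀ h f g → (f +ₚ g) *ₚ h ≈ₚ f *ₚ h +ₚ g *ₚ h
  *ₚ-distribʳ h []      g       = reflₚ
  *ₚ-distribʳ h (a ∷ f) []      = symₚ (+ₚ-identityʳ _)
  *ₚ-distribʳ h (a ∷ f) (b ∷ g) = transₚ
    (+ₚ-cong (·-distribʳ a b h)
      (∷-cong (sym (+-identityˡ 0#)) (*ₚ-distribʳ h f g)))
    (+ₚ-interchange (a ·ₚ h) (b ·ₚ h) (0# ∷ f *ₚ h) (0# ∷ g *ₚ h))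

  ·-*-assoc : ∀ a f g → (a ·ₚ f) *ₚ g ≈ₚ a ·ₚ (f *ₚ g)
  ·-*-assoc a []      g = reflₚ
  ·-*-assoc a (b ∷ f) g = transₚ
    (+ₚ-cong (·-assoc a b g) (∷-cong (sym (zeroʳ a)) (·-*-assoc a f g)))
    (symₚ (·-distribˡ a (b ·ₚ g) (0# ∷ f *ₚ g)))

  *ₚ-assoc : ∀ f g h → (f *ₚ g) *ₚ h ≈ₚ f *ₚ (g *ₚ h)
  *ₚ-assoc []      g h = reflₚ
  *ₚ-assoc (a ∷ f) g h = transₚ
    (*ₚ-distribʳ h (a ·ₚ g) (0# ∷ f *ₚ g))
    (+ₚ-cong (·-*-assoc a g h)
      (+ₚ-cong (·-zeroˡ h) (∷-cong ≈-refl (*ₚ-assoc f g h))))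

  *ₚ-zeroʳ : ∀ f → f *ₚ [] ≈ₚ []
  *ₚ-zeroʳ []      = reflₚ
  *ₚ-zeroʳ (a ∷ f) = transₚ (∷-cong ≈-refl (*ₚ-zeroʳ f)) 0∷0

  *ₚ-∷ : ∀ f b g → f *ₚ (b ∷ g) ≈ₚ b ·ₚ f +ₚ (0# ∷ f *ₚ g)
  *ₚ-∷ []      b g = symₚ 0∷0
  *ₚ-∷ (a ∷ f) b g = ∷-cong (+-congʳ (*-comm a b))
    (transₚ (+ₚ-cong reflₚ (*ₚ-∷ f b g)) (+ₚ-swap (a ·ₚ g) (b ·ₚ f) (0# ∷ f *ₚ g)))

  *ₚ-comm : ∀ f g → f *ₚ g ≈ₚ g *ₚ f
  *ₚ-comm []      g = symₚ (*ₚ-zeroʳ g)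
  *ₚ-comm (a ∷ f) g = transₚ
    (+ₚ-cong reflₚ (∷-cong ≈-refl (*ₚ-comm f g)))
    (symₚ (*ₚ-∷ g a f))

  *ₚ-identityˡ : ∀ f → 1ₚ *ₚ f ≈ₚ f
  *ₚ-identityˡ f = transₚ (+ₚ-cong (·-identityˡ f) 0∷0) (+ₚ-identityʳ f)

  isCommutativeRingₚ : IsCommutativeRing _≈ₚ_ _+ₚ_ _*ₚ_ -ₚ_ 0ₚ 1ₚ
  isCommutativeRingₚ = record
    { isRing = record
      { +-isAbelianGroup = record
        { isGroup = record
          { isMonoid = record
            { isSemigroup = record
              { isMagma = record
                { isEquivalence = record { refl = reflₚ ; sym = symₚ ; trans = transₚ }
                ; ∙-cong = +ₚ-cong
                }
              ; assoc = +ₚ-assoc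
              }
            ; identity = (λ _ → reflₚ) , +ₚ-identityʳ
            }
          ; inverse = -ₚ-inverseˡ , -ₚ-inverseʳ
          ; ⁻¹-cong = -ₚ-cong
          }
        ; comm = +ₚ-comm
        }
      ; *-cong = *ₚ-cong
      ; *-assoc = *ₚ-assoc
      ; *-identity = *ₚ-identityˡ ,
          λ f → transₚ (*ₚ-comm f 1ₚ) (*ₚ-identityˡ f)
      ; distrib =
          (λ f g h → transₚ (*ₚ-comm f (g +ₚ h)) (transₚ (*ₚ-distribʳ f g h)
                       (+ₚ-cong (*ₚ-comm g f) (*ₚ-comm h f)))) ,
          *ₚ-distribʳ
      }
    ; *-comm = *ₚ-comm
    }

  polynomialRing : CommutativeRing c ℓ
  polynomialRing = record { isCommutativeRing = isCommutativeRingₚ }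

open Polynomials using (polynomialRing)

-- Tiles are listed from the bottom of the column upwards.
data Tiling : ℕ → Set where
  []    : Tiling 0
  one∷_ : ∀ {m} → Tiling m → Tiling (1 ℕ.+ m)
  two∷_ : ∀ {m} → Tiling m → Tiling (2 ℕ.+ m)

data FibTiling : ℕ → Set where
  bottom-one∷_ : ∀ {m} → Tiling m → FibTiling (1 ℕ.+ m)

#one #two : ∀ {m} → Tiling m → ℕ
#one []       = 0
#one (one∷ t) = suc (#one t)
#one (two∷ t) = #one t
#two []       = 0
#two (one∷ t) = #two t
#two (two∷ t) = suc (#two t)

one two : ∀ {m} → FibTiling m → ℕ
one (bottom-one∷ t) = suc (#one t)
two (bottom-one∷ t) = #two t

tilings : ∀ m → List (Tiling m)
tilings 0             = [] ∷ []
tilings 1             = List.map one∷_ (tilings 0)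
tilings (suc (suc m)) = List.map one∷_ (tilings (suc m)) ++ List.map two∷_ (tilings m)

fibTilings : ∀ m → List (FibTiling m)
fibTilings zero    = []
fibTilings (suc m) = List.map bottom-one∷_ (tilings m)

record Columns (n k : ℕ) : Set where
  constructor mkColumns
  field
    cols       : Vec (Fin n) k
    increasing : AllPairs Fin._<_ cols
open Columns public

-- i lowered by s.  For the s-th entry (counting from 0) of an increasing
-- sequence of columns the truncation at zero never occurs.
_⊖_ : ∀ {n} → Fin n → ℕ → Fin n
i ⊖ zero  = i
i ⊖ suc s = pred i ⊖ s

-- With columns and entries both counted from 0, the column i chosen as entry s
-- has b (i - s) uncanceled cells; counting from 1 this is b_{i_s-(s-1)}.
uncanceled : ∀ {n k} → (Fin n → ℕ) → Columns n k → Vec ℕ k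
uncanceled b c = Vec.tabulate λ s → b (Vec.lookup (cols c) s ⊖ toℕ s)

record Placement {n} (b : Fin n → ℕ) (k : ℕ) : Set where
  constructor mkPlacement
  field
    columns : Columns n k
    fillers : All FibTiling (uncanceled b columns)
open Placement public

total : (∀ {m} → FibTiling m → ℕ) → ∀ {k} {hs : Vec ℕ k} → All FibTiling hs → ℕ
total f []       = 0
total f (t ∷ ts) = f t ℕ.+ total f ts

here∷ : ∀ {n k} → Columns n k → Columns (suc n) (suc k)
here∷ (mkColumns is inc) = mkColumns (zero ∷ Vec.map suc is)
  (All.map⁺ (All.universal (λ _ → s≤s z≤n) is) ∷ AllPairs.map⁺ (AllPairs.map s≤s inc))

skip : ∀ {n k} → Columns n k → Columns (suc n) k
skip (mkColumns is inc) = mkColumns (Vec.map suc is) (AllPairs.map⁺ (AllPairs.map s≤s inc))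

allColumns : ∀ n k → List (Columns n k)
allColumns n       zero    = mkColumns [] [] ∷ []
allColumns zero    (suc k) = []
allColumns (suc n) (suc k) =
  List.map here∷ (allColumns n k) ++ List.map skip (allColumns n (suc k))

allFillers : ∀ {k} (hs : Vec ℕ k) → List (All FibTiling hs)
allFillers []       = [] ∷ []
allFillers (h ∷ hs) = cartesianProductWith _∷_ (fibTilings h) (allFillers hs)

placements : ∀ {n} (b : Fin n → ℕ) k → List (Placement b k)
placements {n} b k =
  concatMap (λ c → List.map (mkPlacement c) (allFillers (uncanceled b c))) (allColumns n k)

-- The enumerations used for the sums contain every object exactly once.
∈-tilings : ∀ {m} (t : Tiling m) → t ∈ tilings m
∈-tilings {0}           []       = here refl
∈-tilings {1}           (one∷ t) = ∈-map⁺ one∷_ (∈-tilings t)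
∈-tilings {suc (suc m)} (one∷ t) = ∈-++⁺ˡ (∈-map⁺ one∷_ (∈-tilings t))
∈-tilings {suc (suc m)} (two∷ t) =
  ∈-++⁺ʳ (List.map one∷_ (tilings (suc m))) (∈-map⁺ two∷_ (∈-tilings t))

∈-fibTilings : ∀ {m} (t : FibTiling m) → t ∈ fibTilings m
∈-fibTilings (bottom-one∷ t) = ∈-map⁺ bottom-one∷_ (∈-tilings t)

tilings-unique : ∀ m → Unique (tilings m)
tilings-unique 0             = ListAll.[] ListAllPairs.∷ ListAllPairs.[]
tilings-unique 1             = ListAll.[] ListAllPairs.∷ ListAllPairs.[]
tilings-unique (suc (suc m)) = Unique.++⁺
  (Unique.map⁺ (λ { refl → refl }) (tilings-unique (suc m)))
  (Unique.map⁺ (λ { refl → refl }) (tilings-unique m))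
  disjoint
  where
  disjoint : ∀ {t} → t ∈ List.map one∷_ (tilings (suc m)) × t ∈ List.map two∷_ (tilings m) → ⊥
  disjoint (p , q) with ∈-map⁻ one∷_ p | ∈-map⁻ two∷_ q
  ... | _ , _ , refl | _ , _ , ()

fibTilings-unique : ∀ m → Unique (fibTilings m)
fibTilings-unique zero    = ListAllPairs.[]
fibTilings-unique (suc m) = Unique.map⁺ (λ { refl → refl }) (tilings-unique m)

cols-injective : ∀ {n k} {c d : Columns n k} → cols c ≡ cols d → c ≡ d
cols-injective {c = mkColumns is p} {mkColumns .is q} refl =
  ≡.cong (mkColumns is) (AllPairs.irrelevant Fin.<-irrelevant p q)

positive⇒suc : ∀ {n k} (is : Vec (Fin (suc n)) k) → All (zero {n} Fin.<_) is →
               ∃ λ js → is ≡ Vec.map suc js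
positive⇒suc []           []         = [] , refl
positive⇒suc (suc i ∷ is) (_ ∷ 0<is) with positive⇒suc is 0<is
... | js , refl = i ∷ js , refl

map-suc⁻ : ∀ {n k} (is : Vec (Fin n) k) →
           AllPairs Fin._<_ (Vec.map suc is) → AllPairs Fin._<_ is
map-suc⁻ []       []        = []
map-suc⁻ (i ∷ is) (lt ∷ lts) = All.map ℕ.s<s⁻¹ (All.map⁻ lt) ∷ map-suc⁻ is lts

∈-allColumns : ∀ {n k} (c : Columns n k) → c ∈ allColumns n k
∈-allColumns {n}     {zero}  (mkColumns [] [])                   = here refl
∈-allColumns {suc n} {suc k} (mkColumns (zero ∷ is) (lt ∷ lts))
  with positive⇒suc is lt
... | js , refl = ∈-++⁺ˡ (≡.subst (_∈ List.map here∷ (allColumns n k))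
      (cols-injective refl) (∈-map⁺ here∷ (∈-allColumns (mkColumns js (map-suc⁻ js lts)))))
∈-allColumns {suc n} {suc k} (mkColumns (suc i ∷ is) (lt ∷ lts))
  with positive⇒suc is (All.map (ℕ.≤-trans (s≤s z≤n)) lt)
... | js , refl = ∈-++⁺ʳ (List.map here∷ (allColumns n k))
      (≡.subst (_∈ List.map skip (allColumns n (suc k)))
        (cols-injective refl)
        (∈-map⁺ skip (∈-allColumns (mkColumns (i ∷ js) (map-suc⁻ (i ∷ js) (lt ∷ lts))))))

map-suc-injective : ∀ {n k} {is js : Vec (Fin n) k} → Vec.map Fin.suc is ≡ Vec.map suc js → is ≡ js
map-suc-injective {is = []}     {[]}     _ = refl
map-suc-injective {is = i ∷ is} {j ∷ js} e =
  ≡.cong₂ _∷_ (Fin.suc-injective (≡.cong Vec.head e)) (map-suc-injective (∷-injectiveʳ e))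

allColumns-unique : ∀ n k → Unique (allColumns n k)
allColumns-unique n       zero    = ListAll.[] ListAllPairs.∷ ListAllPairs.[]
allColumns-unique zero    (suc k) = ListAllPairs.[]
allColumns-unique (suc n) (suc k) = Unique.++⁺
  (Unique.map⁺ (λ e → cols-injective (map-suc-injective (∷-injectiveʳ (≡.cong cols e))))
    (allColumns-unique n k))
  (Unique.map⁺ (λ e → cols-injective (map-suc-injective (≡.cong cols e)))
    (allColumns-unique n (suc k)))
  disjoint
  where
  disjoint : ∀ {c} → c ∈ List.map here∷ (allColumns n k) ×
                     c ∈ List.map skip (allColumns n (suc k)) → ⊥
  disjoint (p , q) with ∈-map⁻ here∷ p | ∈-map⁻ skip q
  ... | _ , _ , refl | mkColumns (_ ∷ _) _ , _ , ()

∈-allFillers : ∀ {k} {hs : Vec ℕ k} (ts : All FibTiling hs) → ts ∈ allFillers hs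
∈-allFillers []       = here refl
∈-allFillers (t ∷ ts) = ∈-cartesianProductWith⁺ _∷_ (∈-fibTilings t) (∈-allFillers ts)

allFillers-unique : ∀ {k} (hs : Vec ℕ k) → Unique (allFillers hs)
allFillers-unique []       = ListAll.[] ListAllPairs.∷ ListAllPairs.[]
allFillers-unique (h ∷ hs) = Unique.cartesianProductWith⁺ _∷_ (λ { refl → refl , refl })
  (fibTilings-unique h) (allFillers-unique hs)

∈-placements : ∀ {n} {b : Fin n → ℕ} {k} (P : Placement b k) → P ∈ placements b k
∈-placements (mkPlacement c ts) = ∈-concatMap⁺ _
  (Any.map (λ { refl → ∈-map⁺ (mkPlacement c) (∈-allFillers ts) }) (∈-allColumns c))

placements-unique : ∀ {n} (b : Fin n → ℕ) k → Unique (placements b k)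
placements-unique {n} b k = Unique.concat⁺
  (ListAllₚ.map⁺ (ListAll.universal
    (λ c → Unique.map⁺ (λ { refl → refl }) (allFillers-unique (uncanceled b c))) _))
  (ListAllPairsₚ.map⁺ (ListAllPairs.map disjoint (allColumns-unique n k)))
  where
  disjoint : ∀ {c d} → c ≢ d → ∀ {P} →
             P ∈ List.map (mkPlacement c) (allFillers (uncanceled b c)) ×
             P ∈ List.map (mkPlacement d) (allFillers (uncanceled b d)) → ⊥
  disjoint {c} {d} c≢d (p , q) with ∈-map⁻ (mkPlacement c) p | ∈-map⁻ (mkPlacement d) q
  ... | _ , _ , refl | _ , _ , refl = c≢d refl

module Weights {c ℓ} (R : CommutativeRing c ℓ) (p q : CommutativeRing.Carrier R) where

  open CommutativeRing R
  open import Algebra.Properties.Semiring.Exp semiring using (_^_)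

  sumOver : ∀ {a} {I : Set a} → List I → (I → Carrier) → Carrier
  sumOver xs w = List.foldr (λ x acc → w x + acc) 0# xs

  F : ℕ → Carrier
  F m = sumOver (fibTilings m) λ T → q ^ one T * p ^ two T

  rT : ∀ {n} → (Fin n → ℕ) → ℕ → Carrier
  rT b k = sumOver (placements b k) λ P → q ^ total one (fillers P) * p ^ total two (fillers P)

ℤ[p] ℤ[p,q] ℤ[p,q][x] : CommutativeRing 0ℓ 0ℓ
ℤ[p]      = polynomialRing ℤ-ring
ℤ[p,q]    = polynomialRing ℤ[p]
ℤ[p,q][x] = polynomialRing ℤ[p,q]

p q : CommutativeRing.Carrier ℤ[p,q]
p = Polynomials.C ℤ[p] (Polynomials.X ℤ-ring)
q = Polynomials.X ℤ[p]

x : CommutativeRing.Carrier ℤ[p,q][x]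
x = Polynomials.X ℤ[p,q]

const : CommutativeRing.Carrier ℤ[p,q] → CommutativeRing.Carrier ℤ[p,q][x]
const = Polynomials.C ℤ[p,q]

open Weights ℤ[p,q] p q public using (F; rT)

open CommutativeRing ℤ[p,q][x] public using (_≈_; _*_; _-_)
open import Algebra.Properties.Semiring.Exp (CommutativeRing.semiring ℤ[p,q][x]) public
  using (_^_)
open import Algebra.Properties.Monoid.Sum (CommutativeRing.+-monoid ℤ[p,q][x]) public
  using (sum⁺-syntax)
open import Algebra.Properties.Monoid.Sum (CommutativeRing.*-monoid ℤ[p,q][x]) public
  using () renaming (sum to product)

infixl 10 product-syntax
product-syntax : ∀ k → (Fin k → CommutativeRing.Carrier ℤ[p,q][x]) → CommutativeRing.Carrier ℤ[p,q][x]
product-syntax _ = product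

syntax product-syntax k (λ i → f) = ∏[ i < k ] f

{-# OPTIONS --safe #-}

-- Entry s of an increasing column sequence i is tiled at height b (i_s - s), and
-- the numbers i_s - s form an arbitrary weakly increasing sequence in {0, …, n - k}.
-- Hence rT_k is the complete homogeneous symmetric polynomial
-- h_k (F_{b_0}, …, F_{b_{n-k}}), and the theorem is the Newton expansion
--   x^n = Σ_k h_{n-k} (a_0, …, a_k) ∏_{i<k} (x - a_i)
-- at a = F ∘ b.  Splitting h_{n+1-k} according to whether a_0 occurs turns the
-- expansion of x^{n+1} into a_0 x^n + (x - a_0) x^n.
module Submission where

open import Defs hiding (p; q; x; _≈_; _*_; _-_; _^_; F; rT; product)
open import Algebra.Bundles using (CommutativeRing)
open import Data.Fin.Base as Fin using (Fin; zero; suc; toℕ; inject!; inject₁; fromℕ)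
open import Data.Fin.Properties using (toℕ-inject₁; toℕ-fromℕ; toℕ≤pred[n])
open import Data.List.Base as List
  using (List; []; _∷_; _++_; concatMap; cartesianProductWith)
open import Data.Nat.Base as ℕ using (ℕ; zero; suc; _∸_; z≤n; s≤s)
import Data.Nat.Properties as ℕ
open import Data.Vec.Base as Vec using (Vec; []; _∷_)
open import Data.Vec.Functional using (init; last)
open import Data.Vec.Properties using (lookup-map)
open import Data.Vec.Relation.Unary.All as All using (All; []; _∷_)
open import Data.Vec.Relation.Unary.AllPairs using (AllPairs; []; _∷_)
open import Function.Base using (_∘_)
open import Relation.Binary.Core using (_Preserves_⟶_)
open import Relation.Binary.PropositionalEquality as ≡ using (_≡_)

-- Lowered column indices.

inject₁-⊖ : ∀ {n} (i : Fin n) s → inject₁ i ⊖ s ≡ inject₁ (i ⊖ s)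
inject₁-⊖ i       zero    = ≡.refl
inject₁-⊖ zero    (suc s) = inject₁-⊖ zero s
inject₁-⊖ (suc i) (suc s) = inject₁-⊖ (inject₁ i) s

-- The bound rules out truncation: at `i = zero`, `s = 1` the left side is `zero`. Since
-- `pred (suc i)` is `inject₁ i`, the induction continues at `inject₁ i`.
suc-⊖ : ∀ {n} (i : Fin n) s → s ℕ.≤ toℕ i → suc i ⊖ s ≡ suc (i ⊖ s)
suc-⊖ i       zero    _         = ≡.refl
suc-⊖ (suc i) (suc s) (s≤s s≤i) =
  suc-⊖ (inject₁ i) s (≡.subst (s ℕ.≤_) (≡.sym (toℕ-inject₁ i)) s≤i)

-- Each step of a strictly increasing sequence gains at least one. The lower bound `m` is general so
-- that the tail can be treated with `suc m`.
increasing⇒≤lookup : ∀ {n k m} {is : Vec (Fin n) k} →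
  All (λ i → m ℕ.≤ toℕ i) is → AllPairs Fin._<_ is →
  ∀ s → m ℕ.+ toℕ s ℕ.≤ toℕ (Vec.lookup is s)
increasing⇒≤lookup {m = m} {is = i ∷ _} (m≤i ∷ _) _ zero =
  ≡.subst (ℕ._≤ toℕ i) (≡.sym (ℕ.+-identityʳ m)) m≤i
increasing⇒≤lookup {m = m} {is = _ ∷ is} (m≤i ∷ _) (i<is ∷ inc) (suc s) =
  ≡.subst (ℕ._≤ toℕ (Vec.lookup is s)) (≡.sym (ℕ.+-suc m (toℕ s)))
    (increasing⇒≤lookup (All.map (ℕ.≤-trans (s≤s m≤i)) i<is) inc s)

lookup-cols-≥ : ∀ {n k} (c : Columns n k) s → toℕ s ℕ.≤ toℕ (Vec.lookup (cols c) s)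
lookup-cols-≥ c = increasing⇒≤lookup (All.universal (λ _ → z≤n) (cols c)) (increasing c)

-- Newton expansion in a commutative ring.

module Newton {c ℓ} (R : CommutativeRing c ℓ) where

  open CommutativeRing R renaming (zero to *-zero)
  open import Algebra.Properties.Semiring.Exp semiring using (_^_)
  open import Algebra.Properties.Semiring.Sum semiring
    using (sum; sum-cong-≋; sum-init-last; ∑-distrib-+; *-distribˡ-sum)
  open import Algebra.Properties.Monoid.Sum *-monoid using () renaming (sum to product)
  open import Algebra.Properties.CommutativeSemigroup *-commutativeSemigroup
    using (x∙yz≈y∙xz)
  open import Relation.Binary.Reasoning.Setoid setoid

  -- h_k (a₀, …, a_{n-k})
  complete : ∀ {n} → (Fin n → Carrier) → ℕ → Carrier
  complete         a zero    = 1#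
  complete {zero}  a (suc k) = 0#
  complete {suc n} a (suc k) = a zero * complete (a ∘ inject₁) k + complete (a ∘ suc) (suc k)

  -- The polynomial of degree k has n - k + 1 variables, hence none once k exceeds n.
  complete-vanishes : ∀ {n} (a : Fin n → Carrier) {k} → n ℕ.< k → complete a k ≈ 0#
  complete-vanishes {zero}  a {suc k} _         = refl
  complete-vanishes {suc n} a {suc k} (s≤s n<k) = begin
    a zero * complete (a ∘ inject₁) k + complete (a ∘ suc) (suc k)
      ≈⟨ +-cong (*-congˡ (complete-vanishes (a ∘ inject₁) n<k))
                (complete-vanishes (a ∘ suc) (ℕ.m<n⇒m<1+n n<k)) ⟩
    a zero * 0# + 0#  ≈⟨ +-identityʳ _ ⟩
    a zero * 0#       ≈⟨ zeroʳ _ ⟩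
    0#                ∎

  module _ (x : Carrier) where

    basis : ∀ {n} → (Fin n → Carrier) → Fin (suc n) → Carrier
    basis a k = product (λ (i : Fin (toℕ k)) → x - a (inject! i))

    -- At most n factors occur, so the last of the n + 1 points is never read.
    basis-inject₁ : ∀ {n} (a : Fin (suc n) → Carrier) (k : Fin (suc n)) →
                    basis a (inject₁ k) ≡ basis (a ∘ inject₁) k
    basis-inject₁         a zero    = ≡.refl
    basis-inject₁ {suc n} a (suc k) = ≡.cong ((x - a zero) *_) (basis-inject₁ (a ∘ suc) k)

    -- Induction on n for all points at once: the hypothesis is used without the last point for the
    -- terms containing `a zero`, and without the first point for the others.
    newton-expansion : ∀ {n} (a : Fin n → Carrier) →
      x ^ n ≈ sum (λ k → complete a (n ∸ toℕ k) * basis a k)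
    newton-expansion {zero}  a = sym (trans (+-identityʳ _) (*-identityˡ _))
    newton-expansion {suc n} a = sym (begin
      sum f
        -- The top term has degree 0 and admits no splitting, so it is set apart.
        ≈⟨ sum-init-last f ⟩
      sum (init f) + last f
        ≈⟨ +-cong (sum-cong-≋ f-init) f-last ⟩
      sum (λ k → a₀ * f₁ k + init g k) + last g
        ≈⟨ +-congʳ (∑-distrib-+ (λ k → a₀ * f₁ k) (init g)) ⟩
      (sum (λ k → a₀ * f₁ k) + sum (init g)) + last g
        ≈⟨ +-assoc _ _ _ ⟩
      sum (λ k → a₀ * f₁ k) + (sum (init g) + last g)
        ≈⟨ +-cong (*-distribˡ-sum a₀ f₁) (sum-init-last g) ⟨
      a₀ * sum f₁ + sum g
        ≈⟨ +-cong (*-congˡ (sym (newton-expansion (a ∘ inject₁)))) sum-g ⟩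
      a₀ * x ^ n + (x - a₀) * x ^ n
        ≈⟨ distribʳ (x ^ n) a₀ (x - a₀) ⟨
      (a₀ + (x - a₀)) * x ^ n
        ≈⟨ *-congʳ (trans (sym (+-assoc a₀ x (- a₀))) (xyx⁻¹≈y a₀ x)) ⟩
      x * x ^ n ∎)
      where
      open import Algebra.Properties.AbelianGroup +-abelianGroup using (xyx⁻¹≈y)
      a₀ = a zero
      f g : Fin (suc (suc n)) → Carrier
      f k = complete a (suc n ∸ toℕ k) * basis a k
      g k = complete (a ∘ suc) (suc n ∸ toℕ k) * basis a k
      f₁ f₂ : Fin (suc n) → Carrier
      f₁ k = complete (a ∘ inject₁) (n ∸ toℕ k) * basis (a ∘ inject₁) k
      f₂ k = complete (a ∘ suc) (n ∸ toℕ k) * basis (a ∘ suc) k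

      f-init : ∀ k → init f k ≈ a₀ * f₁ k + init g k
      f-init k = begin
        complete a (suc n ∸ toℕ (inject₁ k)) * y
          ≡⟨ ≡.cong (λ d → complete a d * y) degree ⟩
        (a₀ * h₁ + h₂) * y
          -- With the degree in successor form, `complete` unfolds: `h₁` is in a_0, ..., a_k and
          -- `h₂` in a_1, ..., a_k.
          ≈⟨ distribʳ _ _ _ ⟩
        a₀ * h₁ * y + h₂ * y
          ≈⟨ +-congʳ (*-assoc _ _ _) ⟩
        a₀ * (h₁ * y) + h₂ * y
          ≡⟨ ≡.cong₂ (λ z d → a₀ * (h₁ * z) + complete (a ∘ suc) d * y)
                     (basis-inject₁ a k) (≡.sym degree) ⟩
        a₀ * f₁ k + init g k ∎
        where
        y = basis a (inject₁ k)
        h₁ = complete (a ∘ inject₁) (n ∸ toℕ k)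
        h₂ = complete (a ∘ suc) (suc (n ∸ toℕ k))
        degree : suc n ∸ toℕ (inject₁ k) ≡ suc (n ∸ toℕ k)
        degree = ≡.trans (≡.cong (suc n ∸_) (toℕ-inject₁ k)) (ℕ.+-∸-assoc 1 (toℕ≤pred[n] k))

      f-last : last f ≈ last g
      f-last = *-congʳ (reflexive
        (≡.trans (≡.cong (complete a) degree) (≡.cong (complete (a ∘ suc)) (≡.sym degree))))
        where
        degree : n ∸ toℕ (fromℕ n) ≡ 0
        degree = ≡.trans (≡.cong (n ∸_) (toℕ-fromℕ n)) (ℕ.n∸n≡0 n)

      sum-g : sum g ≈ (x - a₀) * x ^ n
      sum-g = begin
        complete (a ∘ suc) (suc n) * 1# + sum (g ∘ suc)
          -- The term k = 0 has degree n + 1 over n points and vanishes; every later product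
          -- contains the factor `x - a₀`, which is pulled out.
          ≈⟨ +-cong (trans (*-identityʳ _) (complete-vanishes (a ∘ suc) (ℕ.n<1+n n)))
                    (sum-cong-≋ {suc n} {g ∘ suc} λ k →
                      x∙yz≈y∙xz (complete (a ∘ suc) (n ∸ toℕ k)) (x - a₀) (basis (a ∘ suc) k)) ⟩
        0# + sum (λ k → (x - a₀) * f₂ k)
          ≈⟨ +-identityˡ _ ⟩
        sum (λ k → (x - a₀) * f₂ k)
          ≈⟨ *-distribˡ-sum (x - a₀) f₂ ⟨
        (x - a₀) * sum f₂
          ≈⟨ *-congˡ (newton-expansion (a ∘ suc)) ⟨
        (x - a₀) * x ^ n ∎

-- Rook sums as complete homogeneous polynomials.

module RookSums {c ℓ} (R : CommutativeRing c ℓ) (p q : CommutativeRing.Carrier R) where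

  open CommutativeRing R renaming (zero to *-zero)
  open Weights R p q
  open Newton R using (complete)
  open import Algebra.Properties.Semiring.Exp semiring using (_^_; ^-homo-*)
  open import Algebra.Properties.Monoid.Sum *-monoid
    using () renaming (sum to product; sum-cong-≗ to product-cong-≗)
  open import Algebra.Properties.CommutativeSemigroup *-commutativeSemigroup
    using (interchange)
  open import Relation.Binary.Reasoning.Setoid setoid

  module _ {i} {I : Set i} where

    sumOver-cong : ∀ (xs : List I) {u v : I → Carrier} →
                   (∀ x → u x ≈ v x) → sumOver xs u ≈ sumOver xs v
    sumOver-cong []       u≈v = refl
    sumOver-cong (x ∷ xs) u≈v = +-cong (u≈v x) (sumOver-cong xs u≈v)

    sumOver-++ : ∀ (xs ys : List I) w → sumOver (xs ++ ys) w ≈ sumOver xs w + sumOver ys w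
    sumOver-++ []       ys w = sym (+-identityˡ _)
    sumOver-++ (x ∷ xs) ys w = trans (+-congˡ (sumOver-++ xs ys w)) (sym (+-assoc _ _ _))

    *-distribˡ-sumOver : ∀ a (xs : List I) w → a * sumOver xs w ≈ sumOver xs (λ x → a * w x)
    *-distribˡ-sumOver a []       w = zeroʳ a
    *-distribˡ-sumOver a (x ∷ xs) w =
      trans (distribˡ a _ _) (+-congˡ (*-distribˡ-sumOver a xs w))

  module _ {i j} {I : Set i} {J : Set j} where

    sumOver-map : ∀ (f : I → J) xs w → sumOver (List.map f xs) w ≡ sumOver xs (w ∘ f)
    sumOver-map f []       w = ≡.refl
    sumOver-map f (x ∷ xs) w = ≡.cong (w (f x) +_) (sumOver-map f xs w)

    sumOver-concatMap : ∀ (f : I → List J) xs w →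
                        sumOver (concatMap f xs) w ≈ sumOver xs (λ x → sumOver (f x) w)
    sumOver-concatMap f []       w = refl
    sumOver-concatMap f (x ∷ xs) w =
      trans (sumOver-++ (f x) _ w) (+-congˡ (sumOver-concatMap f xs w))

  sumOver-cartesianProductWith : ∀ {i j k} {I : Set i} {J : Set j} {K : Set k}
    (f : I → J → K) {u : I → Carrier} {v : J → Carrier} {w : K → Carrier} →
    (∀ x y → w (f x y) ≈ u x * v y) → ∀ xs ys →
    sumOver (cartesianProductWith f xs ys) w ≈ sumOver xs u * sumOver ys v
  sumOver-cartesianProductWith f w≈uv []       ys = sym (zeroˡ _)
  sumOver-cartesianProductWith f {u} {v} {w} w≈uv (x ∷ xs) ys = begin
    sumOver (List.map (f x) ys ++ cartesianProductWith f xs ys) w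
      ≈⟨ sumOver-++ (List.map (f x) ys) _ w ⟩
    sumOver (List.map (f x) ys) w + sumOver (cartesianProductWith f xs ys) w
      ≈⟨ +-cong (reflexive (sumOver-map (f x) ys w)) (sumOver-cartesianProductWith f w≈uv xs ys) ⟩
    sumOver ys (w ∘ f x) + sumOver xs u * sumOver ys v
      ≈⟨ +-congʳ (trans (sumOver-cong ys (w≈uv x)) (sym (*-distribˡ-sumOver (u x) ys v))) ⟩
    u x * sumOver ys v + sumOver xs u * sumOver ys v
      ≈⟨ distribʳ _ _ _ ⟨
    (u x + sumOver xs u) * sumOver ys v ∎

  weight : ∀ {k} {hs : Vec ℕ k} → All FibTiling hs → Carrier
  weight ts = q ^ total one ts * p ^ total two ts

  weight-∷ : ∀ {h k} {hs : Vec ℕ k} (t : FibTiling h) (ts : All FibTiling hs) →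
             weight (t ∷ ts) ≈ (q ^ one t * p ^ two t) * weight ts
  weight-∷ t ts = trans
    (*-cong (^-homo-* q (one t) _) (^-homo-* p (two t) _))
    (interchange _ _ _ _)

  -- Tilings of different columns are chosen independently and the weight is multiplicative, so the
  -- sum factors. The form `Vec.tabulate h` is that of `uncanceled`.
  sum-allFillers : ∀ {k} (h : Fin k → ℕ) →
    sumOver (allFillers (Vec.tabulate h)) weight ≈ product (F ∘ h)
  sum-allFillers {zero}  h = trans (+-identityʳ _) (*-identityˡ _)
  sum-allFillers {suc k} h = trans
    (sumOver-cartesianProductWith _∷_ weight-∷ (fibTilings (h zero)) _)
    (*-congˡ (sum-allFillers (h ∘ suc)))

  columnsWeight : ∀ {n k} → (Fin n → Carrier) → Columns n k → Carrier
  columnsWeight a c = product (λ s → a (Vec.lookup (cols c) s ⊖ toℕ s))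

  -- Every old entry grows by one in both value and position, so its lowered index keeps its value.
  columnsWeight-here∷ : ∀ {n k} (a : Fin (suc n) → Carrier) (c : Columns n k) →
    columnsWeight a (here∷ c) ≡ a zero * columnsWeight (a ∘ inject₁) c
  columnsWeight-here∷ a c = ≡.cong (a zero *_) (product-cong-≗ λ s →
    ≡.cong a (≡.trans (≡.cong (_⊖ suc (toℕ s)) (lookup-map s suc (cols c)))
                      (inject₁-⊖ (Vec.lookup (cols c) s) (toℕ s))))

  -- Entries grow by one but positions stay, so lowered indices grow by one; `lookup-cols-≥`
  -- excludes truncation.
  columnsWeight-skip : ∀ {n k} (a : Fin (suc n) → Carrier) (c : Columns n k) →
    columnsWeight a (skip c) ≡ columnsWeight (a ∘ suc) c
  columnsWeight-skip a c = product-cong-≗ λ s →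
    ≡.cong a (≡.trans (≡.cong (_⊖ toℕ s) (lookup-map s suc (cols c)))
                      (suc-⊖ (Vec.lookup (cols c) s) (toℕ s) (lookup-cols-≥ c s)))

  -- `allColumns` and `complete` recurse alike: choosing column 0 contributes a factor `a zero`,
  -- skipping it discards that variable.
  sum-allColumns : ∀ {n} (a : Fin n → Carrier) k →
    sumOver (allColumns n k) (columnsWeight a) ≈ complete a k
  sum-allColumns         a zero    = +-identityʳ _
  sum-allColumns {zero}  a (suc k) = refl
  sum-allColumns {suc n} a (suc k) = trans
    (sumOver-++ (List.map here∷ (allColumns n k)) _ (columnsWeight a))
    (+-cong
      (begin
        sumOver (List.map here∷ (allColumns n k)) (columnsWeight a)
          ≡⟨ sumOver-map here∷ (allColumns n k) _ ⟩
        sumOver (allColumns n k) (columnsWeight a ∘ here∷)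
          ≈⟨ sumOver-cong (allColumns n k) (λ c → reflexive (columnsWeight-here∷ a c)) ⟩
        sumOver (allColumns n k) (λ c → a zero * columnsWeight (a ∘ inject₁) c)
          ≈⟨ *-distribˡ-sumOver (a zero) (allColumns n k) _ ⟨
        a zero * sumOver (allColumns n k) (columnsWeight (a ∘ inject₁))
          ≈⟨ *-congˡ (sum-allColumns (a ∘ inject₁) k) ⟩
        a zero * complete (a ∘ inject₁) k ∎)
      (begin
        sumOver (List.map skip (allColumns n (suc k))) (columnsWeight a)
          ≡⟨ sumOver-map skip (allColumns n (suc k)) _ ⟩
        sumOver (allColumns n (suc k)) (columnsWeight a ∘ skip)
          ≈⟨ sumOver-cong (allColumns n (suc k)) (λ c → reflexive (columnsWeight-skip a c)) ⟩
        sumOver (allColumns n (suc k)) (columnsWeight (a ∘ suc))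
          ≈⟨ sum-allColumns (a ∘ suc) (suc k) ⟩
        complete (a ∘ suc) (suc k) ∎))

  rT≈complete : ∀ {n} (b : Fin n → ℕ) k → rT b k ≈ complete (F ∘ b) k
  rT≈complete {n} b k = begin
    sumOver (placements b k) w
      ≈⟨ sumOver-concatMap placementsIn (allColumns n k) w ⟩
    sumOver (allColumns n k) (λ c → sumOver (placementsIn c) w)
      -- For fixed columns, the sum over fillers is the product of `F` at the uncanceled heights.
      ≈⟨ sumOver-cong (allColumns n k) (λ c → trans
           (reflexive (sumOver-map (mkPlacement c) (allFillers (uncanceled b c)) w))
           (sum-allFillers (λ s → b (Vec.lookup (cols c) s ⊖ toℕ s)))) ⟩
    sumOver (allColumns n k) (columnsWeight (F ∘ b))
      ≈⟨ sum-allColumns (F ∘ b) k ⟩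
    complete (F ∘ b) k ∎
    where
    w : Placement b k → Carrier
    w P = weight (fillers P)
    placementsIn : Columns n k → List (Placement b k)
    placementsIn c = List.map (mkPlacement c) (allFillers (uncanceled b c))

-- Passage from coefficients to constant polynomials.

module Constants {c ℓ} (R : CommutativeRing c ℓ) where

  open CommutativeRing R using (Carrier)
    renaming (_*_ to _*ᵣ_; sym to symᵣ; +-identityʳ to +ᵣ-identityʳ)
  open Polynomials R using (C; polynomialRing; 0∷0; ∷-cong; reflₚ)
  open CommutativeRing polynomialRing
    using (_≈_; _*_; refl; sym; trans; +-cong; *-congˡ)
  open Newton using (complete)

  C-homo-* : ∀ a b → C (a *ᵣ b) ≈ C a * C b
  C-homo-* a b = ∷-cong (symᵣ (+ᵣ-identityʳ _)) reflₚ

  -- `complete` is built from 0, 1, sums and products, all of which `C` respects. Zero is respected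
  -- only up to `_≈_`, because `C 0#` is a one-entry list.
  C-complete : ∀ {n} (a : Fin n → Carrier) k →
               C (complete R a k) ≈ complete polynomialRing (C ∘ a) k
  C-complete         a zero    = refl
  C-complete {zero}  a (suc k) = 0∷0
  C-complete {suc n} a (suc k) = +-cong
    (trans (C-homo-* (a zero) _) (*-congˡ {C (a zero)} (C-complete (a ∘ inject₁) k)))
    (C-complete (a ∘ suc) (suc k))

open Defs using (p; q; x; _≈_; _*_; _-_; _^_; F; rT; product)

theorem4 : ∀ {n : ℕ} (b : Fin n → ℕ) → b Preserves Fin._≤_ ⟶ ℕ._≤_ →
    x ^ n ≈ ∑[ k ≤ n ] (const (rT b (n ∸ toℕ k)) * ∏[ i < toℕ k ] (x - const (F (b (inject! i)))))
theorem4 {n} b _ = trans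
  -- The points are the constants `F (b i)`; the coefficients are then identified with rook sums
  -- term by term.
  (newton-expansion x (const ∘ F ∘ b))
  (sum-cong-≋ {suc n} λ k → *-congʳ {basis x (const ∘ F ∘ b) k} (sym (const-rT (n ∸ toℕ k))))
  where
  open CommutativeRing ℤ[p,q][x] using (sym; trans; *-congʳ; +-monoid)
  open import Algebra.Properties.Monoid.Sum +-monoid using (sum-cong-≋)
  open Newton ℤ[p,q][x] using (complete; basis; newton-expansion)
  open Polynomials ℤ[p,q] using (∷-cong; reflₚ)

  const-rT : ∀ k → const (rT b k) ≈ complete (const ∘ F ∘ b) k
  const-rT k = trans
    (∷-cong (RookSums.rT≈complete ℤ[p,q] p q b k) reflₚ)
    (Constants.C-complete ℤ[p,q] (F ∘ b) k)
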